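{- For every integer $n\ge 2$, $r_3(4, P_n) < 6nm$, where $m= r(P_n^2, P_n^2)$.
   Context: The 3-uniform tight path $P_n$ has vertices $v_1<\cdots<v_n$ and edges $\{v_j,v_{j+1},v_{j+2}\}$ for $j=1,\dots,n-2$; in a red/blue coloring of the 3-subsets of $[N]$, a blue copy of $P_n$ is a sequence $x_1<\cdots<x_n$ in $[N]$ with every triple $\{x_j,x_{j+1},x_{j+2}\}$ blue. $r_3(4,P_n)$ is the minimum $N$ such that every red/blue coloring of the 3-subsets of $[N]$ contains either 4 vertices all of whose triples are red or a blue copy of $P_n$. The graph $P_n^2$ is the ordered graph on $v_1<\cdots<v_n$ with edges $v_iv_j$ for $1\le|i-j|\le 2$; $r(P_n^2,P_n^2)$ is the minimum $N$ such that every red/blue coloring of the edges of the complete graph on $[N]$ contains vertices $x_1<\cdots<x_n$ with all pairs $x_ix_j$, $1\le |i-j|\le 2$, of the same color. -}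

module Defs where

open import Data.Nat using (ℕ; zero; suc; _+_; _*_; _<_; _≤_)
open import Data.Fin using (Fin; toℕ)
open import Data.Bool using (Bool; true; false)
open import Data.Product using (Σ; _×_; ∃)
open import Data.Sum using (_⊎_)
open import Relation.Binary.PropositionalEquality using (_≡_)
open import Relation.Nullary using (¬_)

red blue : Bool
red = true
blue = false

_<ᶠ_ : ∀ {N} → Fin N → Fin N → Set
a <ᶠ b = toℕ a < toℕ b

-- A red/blue coloring of the 3-subsets of [N]: the 3-subset {a<b<c} is
-- represented by its increasing enumeration (a, b, c).
Coloring3 : ℕ → Set
Coloring3 N = (a b c : Fin N) → a <ᶠ b → b <ᶠ c → Bool

Coloring2 : ℕ → Set
Coloring2 N = (a b : Fin N) → a <ᶠ b → Bool

Increasing : ∀ {n N} → (Fin n → Fin N) → Set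
Increasing {n} x = (i j : Fin n) → toℕ i < toℕ j → x i <ᶠ x j

RedK4 : ∀ {N} → Coloring3 N → Set
RedK4 {N} χ =
  Σ (Fin N) λ a → Σ (Fin N) λ b → Σ (Fin N) λ c → Σ (Fin N) λ d →
  Σ (a <ᶠ b) λ ab → Σ (b <ᶠ c) λ bc → Σ (c <ᶠ d) λ cd →
  Σ (a <ᶠ c) λ ac → Σ (b <ᶠ d) λ bd →
    (χ a b c ab bc ≡ red) × (χ a b d ab bd ≡ red) ×
    (χ a c d ac cd ≡ red) × (χ b c d bc cd ≡ red)

BluePath : ∀ {N} → ℕ → Coloring3 N → Set
BluePath {N} n χ =
  Σ (Fin n → Fin N) λ x → Σ (Increasing x) λ inc →
    (j k l : Fin n) → (jk : toℕ k ≡ suc (toℕ j)) → (kl : toℕ l ≡ suc (toℕ k)) →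
    ∀ (p : x j <ᶠ x k) (q : x k <ᶠ x l) → χ (x j) (x k) (x l) p q ≡ blue

Arrows3 : ℕ → ℕ → Set
Arrows3 n N = (χ : Coloring3 N) → RedK4 χ ⊎ BluePath n χ

IsR3 : ℕ → ℕ → Set
IsR3 n r = Arrows3 n r × ((M : ℕ) → M < r → ¬ Arrows3 n M)

MonoSqPath : ∀ {N} → ℕ → Coloring2 N → Bool → Set
MonoSqPath {N} n χ col =
  Σ (Fin n → Fin N) λ x → Σ (Increasing x) λ inc →
    (i j : Fin n) → toℕ i < toℕ j → toℕ j ≤ toℕ i + 2 →
    ∀ (p : x i <ᶠ x j) → χ (x i) (x j) p ≡ col

Arrows2 : ℕ → ℕ → Set
Arrows2 n N = (χ : Coloring2 N) → Σ Bool λ col → MonoSqPath n χ col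

IsR2 : ℕ → ℕ → Set
IsR2 n m = Arrows2 n m × ((M : ℕ) → M < m → ¬ Arrows2 n M)

{-# OPTIONS --safe #-}
module Submission where

-- For a colouring without red K₄ let ℓ(a,b) be the length of the longest blue tight path
-- starting with a, b; a triple abc with ℓ(a,b) ≤ ℓ(b,c) is red.  Suppose v < A < w, |A| = m
-- and ℓ(v,a) ≤ s ≤ ℓ(a,w) on A.  Colouring the pairs ab of A by whether ℓ(a,b) > s gives a
-- copy of P_n² all of whose pairs form red triples with v, or all with w; as there is no
-- red K₄, its consecutive triples are blue, which is the required path.  So assume there is
-- no such configuration, and let X have 2m vertices, all with ℓ(a,w) ≥ s.  Each v before X
-- then has ℓ(v,a) > s for more than half of X, so among 4m such v some a ∈ X has 2m with
-- ℓ(v,a) > s.  Iterating, 4m(n-2) + 2m + 1 vertices force a blue path.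

open import Defs
open import Data.Nat using (ℕ; _≤_; _<_; _*_)
open import Data.Product using (Σ; _×_)

open import Data.Nat using (zero; suc; _+_; s≤s; z≤n; s<s; z<s; _<?_; _≤?_; >-nonZero; NonZero)
open import Data.Nat.Properties
open import Data.Nat.Induction using (<-rec)
open import Data.Nat.ListAction using (sum)
open import Data.Nat.Tactic.RingSolver using (solve-∀)
open import Algebra.Properties.CommutativeSemigroup +-commutativeSemigroup using (x∙yz≈y∙xz)
open import Data.Bool using (Bool; true; false)
import Data.Bool.Properties as Bool
open import Data.Empty using (⊥; ⊥-elim)
open import Data.Fin using (Fin; zero; suc; toℕ; inject≤; combine; remQuot)
open import Data.Fin.Properties using (any?; toℕ-inject≤; remQuot-combine)
open import Data.Fin.Subset using (Subset)
open import Data.Fin.Subset.Properties using (anySubset?)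
open import Data.List using (List; []; _∷_; _++_; length; map; filter; take; drop; lookup)
open import Data.List.Properties using (length-take; length-drop; length-tabulate; take++drop≡id)
open import Data.List.Membership.Propositional using (_∈_)
open import Data.List.Membership.Propositional.Properties using (∈-lookup)
open import Data.List.Relation.Binary.Sublist.Propositional using (_⊆_; ⊆-trans)
open import Data.List.Relation.Binary.Sublist.Propositional.Properties
  using (All-resp-⊆; take-⊆; filter-⊆)
open import Data.List.Relation.Unary.All as All using (All; []; _∷_)
import Data.List.Relation.Unary.All.Properties as All
open import Data.List.Relation.Unary.AllPairs using (AllPairs; []; _∷_)
import Data.List.Relation.Unary.AllPairs.Properties as AllPairs
open import Data.List.Relation.Unary.Any using (here; there)
open import Data.Product using (∃; ∃₂; _,_; proj₁; proj₂)
open import Data.Sum using (_⊎_; inj₁; inj₂)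
import Data.Sum as Sum
import Data.Vec as Vec
open import Data.Vec.Properties using (lookup∘tabulate)
open import Function using (_∘_)
open import Relation.Binary.PropositionalEquality
  using (_≡_; refl; sym; trans; cong; cong₂; subst; subst₂)
open import Relation.Nullary using (¬_; Dec; yes; no; does)
open import Relation.Nullary.Decidable using (map′; _×-dec_; _⊎-dec_; ¬?; decidable-stable)
open import Relation.Unary using (Decidable)
open import Relation.Unary.Properties using (∁?)

-- Decidability and minimal witnesses.

does-true : ∀ {P : Set} (P? : Dec P) → does P? ≡ true → P
does-true (yes p) _ = p

does-false : ∀ {P : Set} (P? : Dec P) → does P? ≡ false → ¬ P
does-false (no ¬p) _ = ¬p

-- Turns an upper bound into an exact minimum: with `P` decidable, one searches below the current
-- witness until nothing smaller is found.
least : {P : ℕ → Set} → Decidable P → ∀ N → P N →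
  ∃ λ r → r ≤ N × P r × (∀ M → M < r → ¬ P M)
least {P} P? = <-rec _ search
  where
  search : ∀ N → (∀ {K} → K < N → P K → ∃ λ r → r ≤ K × P r × (∀ M → M < r → ¬ P M)) →
    P N → ∃ λ r → r ≤ N × P r × (∀ M → M < r → ¬ P M)
  search N rec pN with anyUpTo? P? N
  ... | no none = N , ≤-refl , pN , λ M M<N pM → none (M , M<N , pM)
  ... | yes (K , K<N , pK) with rec K<N pK
  ...   | r , r≤K , minimal = r , ≤-trans r≤K (<⇒≤ K<N) , minimal

-- Sorted lists, counting and averaging.

module _ {A : Set} where

  AllPairs-lookup : ∀ {R : A → A → Set} {xs} → AllPairs R xs →
    ∀ {i j} → toℕ i < toℕ j → R (lookup xs i) (lookup xs j)
  AllPairs-lookup (px ∷ _)  {zero}  {suc j} _         = All.lookup px (∈-lookup j)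
  AllPairs-lookup (_ ∷ pxs) {suc i} {suc j} (s<s i<j) = AllPairs-lookup pxs i<j

  AllPairs-++⁻ : ∀ {R : A → A → Set} xs {ys} → AllPairs R (xs ++ ys) → All (λ x → All (R x) ys) xs
  AllPairs-++⁻ []       _          = []
  AllPairs-++⁻ (x ∷ xs) (px ∷ pxs) = All.++⁻ʳ xs px ∷ AllPairs-++⁻ xs pxs

  count : ∀ {P : A → Set} → Decidable P → List A → ℕ
  count P? xs = length (filter P? xs)

  count-∁ : ∀ {P : A → Set} (P? : Decidable P) xs → count P? xs + count (∁? P?) xs ≡ length xs
  count-∁ P? []       = refl
  count-∁ P? (x ∷ xs) with does (P? x)
  ... | true  = cong suc (count-∁ P? xs)
  ... | false = trans (+-suc _ _) (cong suc (count-∁ P? xs))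

  sum≤length*max : ∀ (f : A → ℕ) x xs →
    ∃ λ a → a ∈ x ∷ xs × sum (map f (x ∷ xs)) ≤ length (x ∷ xs) * f a
  sum≤length*max f x [] = x , here refl , ≤-refl
  sum≤length*max f x (y ∷ ys) with sum≤length*max f y ys
  ... | a , a∈ , bound with ≤-total (f x) (f a)
  ...   | inj₁ fx≤fa = a , there a∈ , +-mono-≤ fx≤fa bound
  ...   | inj₂ fa≤fx = x , here refl ,
          +-monoʳ-≤ (f x) (≤-trans bound (*-monoʳ-≤ (length (y ∷ ys)) fa≤fx))

module _ {A B : Set} {R : A → B → Set} (R? : ∀ a b → Dec (R a b)) where

  sum-count-∷ : ∀ a as bs →
    sum (map (λ b → count (λ a → R? a b) (a ∷ as)) bs)
      ≡ count (R? a) bs + sum (map (λ b → count (λ a → R? a b) as) bs)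
  sum-count-∷ a as []       = refl
  sum-count-∷ a as (b ∷ bs) with does (R? a b) | sum-count-∷ a as bs
  ... | true  | ih = cong suc (trans (cong (count (λ a → R? a b) as +_) ih)
        (x∙yz≈y∙xz (count (λ a → R? a b) as) (count (R? a) bs) _))
  ... | false | ih = trans (cong (count (λ a → R? a b) as +_) ih)
        (x∙yz≈y∙xz (count (λ a → R? a b) as) (count (R? a) bs) _)

  -- Both sides bound the number of pairs related by `R`: the left from below, with at least `t` per
  -- row; the right exactly, summed by columns.
  double-count : ∀ t {as} bs → All (λ a → t ≤ count (R? a) bs) as →
    length as * t ≤ sum (map (λ b → count (λ a → R? a b) as) bs)
  double-count t bs []                   = z≤n
  double-count t bs (_∷_ {a} {as} ta tas) = begin
    t + length as * t
      ≤⟨ +-mono-≤ ta (double-count t bs tas) ⟩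
    count (R? a) bs + sum (map (λ b → count (λ a → R? a b) as) bs)
      ≡⟨ sum-count-∷ a as bs ⟨
    sum (map (λ b → count (λ a → R? a b) (a ∷ as)) bs) ∎
    where open ≤-Reasoning

  -- Averaging: the column with the largest count is at least as large as the mean.
  popular : ∀ t {as} bs → 0 < length bs → All (λ a → t ≤ count (R? a) bs) as →
    ∃ λ b → b ∈ bs × length as * t ≤ length bs * count (λ a → R? a b) as
  popular t {as} (b ∷ bs) _ tas with sum≤length*max (λ b → count (λ a → R? a b) as) b bs
  ... | c , c∈ , bound = c , c∈ , ≤-trans (double-count t (b ∷ bs) tas) bound

-- Coloured triples and blue tight paths.

module _ {N : ℕ} (χ : Coloring3 N) where

  -- Bundling the order proofs makes sense of the predicate for arbitrary triples, so `any?` can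
  -- search over it; which proofs are chosen does not matter, by `<-irrelevant`.
  Coloured : Bool → (a b c : Fin N) → Set
  Coloured col a b c = Σ (a <ᶠ b) λ p → Σ (b <ᶠ c) λ q → χ a b c p q ≡ col

  coloured⇒≡ : ∀ {col a b c} → Coloured col a b c → ∀ p q → χ a b c p q ≡ col
  coloured⇒≡ {a = a} {b} {c} (p′ , q′ , eq) p q =
    trans (cong₂ (χ a b c) (<-irrelevant p p′) (<-irrelevant q q′)) eq

  coloured? : ∀ col a b c → Dec (Coloured col a b c)
  coloured? col a b c with toℕ a <? toℕ b | toℕ b <? toℕ c
  ... | no a≮b | _      = no (a≮b ∘ proj₁)
  ... | yes _  | no b≮c = no (b≮c ∘ proj₁ ∘ proj₂)
  ... | yes p  | yes q  =
    map′ (λ eq → p , q , eq) (λ h → coloured⇒≡ h p q) (χ a b c p q Bool.≟ col)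

  ¬blue⇒red : ∀ {a b c} → a <ᶠ b → b <ᶠ c → ¬ Coloured blue a b c → Coloured red a b c
  ¬blue⇒red p q ¬blue = p , q , Bool.¬-not λ eq → ¬blue (p , q , eq)

  redK4 : ∀ {a b c d} → Coloured red a b c → Coloured red a b d →
    Coloured red a c d → Coloured red b c d → RedK4 χ
  redK4 {a} {b} {c} {d} (ab , bc , eq) (_ , bd , eq₁) (ac , cd , eq₂) bcd =
    a , b , c , d , ab , bc , cd , ac , bd ,
    eq , coloured⇒≡ (_ , _ , eq₁) ab bd , eq₂ , coloured⇒≡ bcd bc cd

  redK4? : Dec (RedK4 χ)
  redK4? = map′
    (λ (a , b , c , d , abc , abd , acd , bcd) → redK4 abc abd acd bcd)
    (λ (a , b , c , d , ab , bc , cd , ac , bd , abc , abd , acd , bcd) →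
      a , b , c , d , (ab , bc , abc) , (ab , bd , abd) , (ac , cd , acd) , (bc , cd , bcd))
    (any? λ a → any? λ b → any? λ c → any? λ d →
      coloured? red a b c ×-dec coloured? red a b d ×-dec
      coloured? red a c d ×-dec coloured? red b c d)

  -- A blue tight path with k + 2 vertices, the first two being a and b; so Path k a b says
  -- ℓ(a,b) ≥ k if ℓ does not count the first two vertices.
  Path : ℕ → (a b : Fin N) → Set
  Path zero    a b = a <ᶠ b
  Path (suc k) a b = ∃ λ c → Coloured blue a b c × Path k b c

  path? : ∀ k a b → Dec (Path k a b)
  path? zero    a b = toℕ a <? toℕ b
  path? (suc k) a b = any? λ c → coloured? blue a b c ×-dec path? k b c

  path⇒< : ∀ k {a b} → Path k a b → a <ᶠ b
  path⇒< zero    a<b                   = a<b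
  path⇒< (suc k) (_ , (a<b , _) , _) = a<b

  path-pred : ∀ k {a b} → Path (suc k) a b → Path k a b
  path-pred zero    (_ , (a<b , _) , _) = a<b
  path-pred (suc k) (c , abc , bc)      = c , abc , path-pred k bc

  -- The equations for the first two vertices carry the induction: they let the triple `a`, `b`, `c`
  -- be glued to the path starting with `b`, `c`.
  path⇒bluePath : ∀ k {a b} → Path k a b →
    Σ (BluePath (2 + k) χ) λ (x , _) → x zero ≡ a × x (suc zero) ≡ b
  path⇒bluePath zero {a} {b} a<b = (x , inc , mono) , refl , refl
    where
    x : Fin 2 → Fin N
    x zero    = a
    x (suc _) = b

    inc : Increasing x
    inc zero       (suc zero) _ = a<b
    inc (suc zero) (suc zero) (s<s ())

    mono : ∀ j k l → toℕ k ≡ suc (toℕ j) → toℕ l ≡ suc (toℕ k) →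
      ∀ p q → χ (x j) (x k) (x l) p q ≡ blue
    mono zero    zero       _          () _
    mono _       (suc zero) zero       _ ()
    mono _       (suc zero) (suc zero) _ ()
    mono (suc _) zero       _          () _
  path⇒bluePath (suc k) {a} {b} (c , abc , bc) with path⇒bluePath k bc
  ... | (y , inc , mono) , refl , refl = (x , inc′ , mono′) , refl , refl
    where
    x : Fin (3 + k) → Fin N
    x zero    = a
    x (suc i) = y i

    inc′ : Increasing x
    inc′ zero    (suc zero)    _         = proj₁ abc
    inc′ zero    (suc (suc j)) _         = <-trans (proj₁ abc) (inc zero (suc j) z<s)
    inc′ (suc i) (suc j)       (s<s i<j) = inc i j i<j

    mono′ : ∀ j k l → toℕ k ≡ suc (toℕ j) → toℕ l ≡ suc (toℕ k) →
      ∀ p q → χ (x j) (x k) (x l) p q ≡ blue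
    mono′ zero    (suc zero) (suc (suc zero)) _ _ = coloured⇒≡ abc
    mono′ (suc i) (suc j)    (suc l)          e f = mono i j l (suc-injective e) (suc-injective f)

  bluePath⇒path : ∀ k ((x , _) : BluePath (2 + k) χ) → Path k (x zero) (x (suc zero))
  bluePath⇒path zero    (x , inc , _)    = inc zero (suc zero) z<s
  bluePath⇒path (suc k) (x , inc , mono) =
    x (suc (suc zero)) ,
    (inc _ _ z<s , inc _ _ (s<s z<s) , mono zero (suc zero) (suc (suc zero)) refl refl _ _) ,
    bluePath⇒path k (x ∘ suc , (λ i j i<j → inc (suc i) (suc j) (s<s i<j)) ,
      λ i j l e f → mono (suc i) (suc j) (suc l) (cong suc e) (cong suc f))

  bluePath? : ∀ k → Dec (BluePath (2 + k) χ)
  bluePath? k = map′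
    (λ (a , b , ab) → proj₁ (path⇒bluePath k ab))
    (λ bp → _ , _ , bluePath⇒path k bp)
    (any? λ a → any? λ b → path? k a b)

  goal? : ∀ k → Dec (RedK4 χ ⊎ BluePath (2 + k) χ)
  goal? k = redK4? ⊎-dec bluePath? k

-- Deciding the arrow relation by finite search.

module _ {N : ℕ} where

  triple : Fin (N * (N * N)) → Fin N × Fin N × Fin N
  triple i = let a , bc = remQuot (N * N) i in a , remQuot N bc

  triple-combine : ∀ a b c → triple (combine a (combine b c)) ≡ (a , b , c)
  triple-combine a b c = trans
    (cong (λ (a , bc) → a , remQuot N bc) (remQuot-combine a (combine b c)))
    (cong (a ,_) (remQuot-combine b c))

  -- One bit per triple of vertices. Colorings are functions of order proofs too, whereas subsets
  -- can be searched exhaustively; bits at triples that are not increasing are never read.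
  decode : Subset (N * (N * N)) → Coloring3 N
  decode s a b c _ _ = Vec.lookup s (combine a (combine b c))

  isRed : Coloring3 N → Fin N × Fin N × Fin N → Bool
  isRed χ (a , b , c) = does (coloured? χ red a b c)

  encode : Coloring3 N → Subset (N * (N * N))
  encode χ = Vec.tabulate (isRed χ ∘ triple)

  isRed-correct : ∀ χ a b c p q → isRed χ (a , b , c) ≡ χ a b c p q
  isRed-correct χ a b c p q with coloured? χ red a b c
  ... | yes abc = sym (coloured⇒≡ χ abc p q)
  ... | no ¬abc = sym (Bool.¬-not λ eq → ¬abc (p , q , eq))

  decode-encode : ∀ χ a b c p q → decode (encode χ) a b c p q ≡ χ a b c p q
  decode-encode χ a b c p q = trans
    (lookup∘tabulate (isRed χ ∘ triple) (combine a (combine b c)))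
    (trans (cong (isRed χ) (triple-combine a b c)) (isRed-correct χ a b c p q))

arrows3? : ∀ k N → Dec (Arrows3 (2 + k) N)
arrows3? k N with anySubset? (λ s → ¬? (goal? (decode {N} s) k))
... | yes (s , ¬goal) = no λ arrows → ¬goal (arrows (decode s))
-- `decode (encode χ)` agrees with `χ` only pointwise, so the structure found in it is carried over
-- to `χ`.
... | no none = yes λ χ → Sum.map (red⇒ χ) (blue⇒ χ)
        (decidable-stable (goal? (decode (encode χ)) k) λ ¬goal → none (encode χ , ¬goal))
  where
  back : ∀ χ {col a b c p q} → decode (encode χ) a b c p q ≡ col → χ a b c p q ≡ col
  back χ = trans (sym (decode-encode χ _ _ _ _ _))

  red⇒ : ∀ χ → RedK4 (decode (encode χ)) → RedK4 χ
  red⇒ χ (a , b , c , d , ab , bc , cd , ac , bd , abc , abd , acd , bcd) =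
    a , b , c , d , ab , bc , cd , ac , bd ,
    back χ abc , back χ abd , back χ acd , back χ bcd

  blue⇒ : ∀ χ → BluePath (2 + k) (decode (encode χ)) → BluePath (2 + k) χ
  blue⇒ χ (x , inc , mono) = x , inc , λ i j l e f p q → back χ (mono i j l e f p q)

-- Squares of paths inside a sorted list.

module _ {n m : ℕ} (arrows : Arrows2 n m) {N : ℕ} {R : Fin N → Fin N → Set} (R? : ∀ a b → Dec (R a b)) where

  SqPath : List (Fin N) → (Fin N → Fin N → Set) → Set
  SqPath A S = Σ (Fin n → Fin N) λ x → Increasing x × (∀ i → x i ∈ A) ×
    (∀ i j → toℕ i < toℕ j → toℕ j ≤ toℕ i + 2 → S (x i) (x j))

  -- The first `m` entries of `A` serve as the vertex set, each pair coloured by whether `R` holds.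
  sqPath : ∀ {A} → AllPairs _<ᶠ_ A → m ≤ length A →
    SqPath A R ⊎ SqPath A (λ a b → ¬ R a b)
  sqPath {A} sorted m≤ = result (arrows pairs)
    where
    e : Fin m → Fin N
    e i = lookup A (inject≤ i m≤)

    e-increasing : Increasing e
    e-increasing i j i<j = AllPairs-lookup sorted
      (subst₂ _<_ (sym (toℕ-inject≤ i m≤)) (sym (toℕ-inject≤ j m≤)) i<j)

    pairs : Coloring2 m
    pairs i j _ = does (R? (e i) (e j))

    result : Σ Bool (MonoSqPath n pairs) → SqPath A R ⊎ SqPath A (λ a b → ¬ R a b)
    result (true , x , inc , mono) =
      inj₁ (e ∘ x , (λ i j → e-increasing (x i) (x j) ∘ inc i j) ,
        (λ i → ∈-lookup (inject≤ (x i) m≤)) ,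
        λ i j i<j j≤i+2 → does-true (R? _ _) (mono i j i<j j≤i+2 (inc i j i<j)))
    result (false , x , inc , mono) =
      inj₂ (e ∘ x , (λ i j → e-increasing (x i) (x j) ∘ inc i j) ,
        (λ i → ∈-lookup (inject≤ (x i) m≤)) ,
        λ i j i<j j≤i+2 → does-false (R? _ _) (mono i j i<j j≤i+2 (inc i j i<j)))

-- Growing blue paths in a coloring without red K₄.

module _ {n m : ℕ} (arrows : Arrows2 n m) (0<m : 0 < m) {N : ℕ} (χ : Coloring3 N)
  (¬red : ¬ RedK4 χ) (¬blue : ¬ BluePath n χ) where

  -- If no triple within a window of three indices is red, then all consecutive triples are blue and
  -- `x` is a blue `P_n`.
  sq⇒⊥ : ∀ (x : Fin n → Fin N) → Increasing x →
    (∀ i j k → toℕ i < toℕ j → toℕ j < toℕ k → toℕ k ≤ toℕ i + 2 →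
      Coloured χ red (x i) (x j) (x k) → ⊥) → ⊥
  sq⇒⊥ x inc ¬redTriple = ¬blue (x , inc , λ i j k e f p q → Bool.¬-not λ eq →
    ¬redTriple i j k (≤-reflexive (sym e)) (≤-reflexive (sym f))
      (≤-reflexive (trans f (trans (cong suc e) (+-comm 2 _)))) (p , q , eq))

  few : ∀ s v w {A} → AllPairs _<ᶠ_ A → All (v <ᶠ_) A →
    All (λ a → ¬ Path χ (suc s) v a) A → All (λ a → Path χ s a w) A → length A < m
  few s v w {A} sorted v<A ¬va aw with m ≤? length A
  ... | no m≰ = ≰⇒> m≰
  ... | yes m≤ with sqPath arrows (path? χ (suc s)) sorted m≤
  -- Were `v`, `x i`, `x j` blue, prepending `v` to the long path from `x i`, `x j` would make the
  -- path from `v`, `x i` too long. So these triples are red, and a red `xxx` would complete a red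
  -- K₄ with `v`.
  ...   | inj₁ (x , inc , x∈ , long) = ⊥-elim (sq⇒⊥ x inc λ i j k i<j j<k k≤ xxx →
          let va i j i<j j≤ = ¬blue⇒red χ (All.lookup v<A (x∈ i)) (inc i j i<j)
                λ vab → All.lookup ¬va (x∈ i) (path-pred χ (suc s) (x j , vab , long i j i<j j≤))
              j≤ = ≤-trans (<⇒≤ j<k) k≤
          in ¬red (redK4 χ (va i j i<j j≤) (va i k (<-trans i<j j<k) k≤)
               (va j k j<k (≤-trans k≤ (+-monoˡ-≤ 2 (<⇒≤ i<j)))) xxx))
  -- Dually, a blue triple `x i`, `x j`, `w` would extend the path from `x j`, `w` to one of level
  -- `suc s` from `x i`, `x j`. So these triples are red, and `w` is the fourth vertex.
  ...   | inj₂ (x , inc , x∈ , short) = ⊥-elim (sq⇒⊥ x inc λ i j k i<j j<k k≤ xxx →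
          let aw i j i<j j≤ = ¬blue⇒red χ (inc i j i<j) (path⇒< χ s (All.lookup aw (x∈ j)))
                λ abw → short i j i<j j≤ (w , abw , All.lookup aw (x∈ j))
              j≤ = ≤-trans (<⇒≤ j<k) k≤
          in ¬red (redK4 χ xxx (aw i j i<j j≤) (aw i k (<-trans i<j j<k) k≤)
               (aw j k j<k (≤-trans k≤ (+-monoˡ-≤ 2 (<⇒≤ i<j))))))

  -- The size `2 * m` is chosen so that losing fewer than `m` vertices of `X` leaves at least half
  -- of it.
  Fan : ℕ → List (Fin N) → Set
  Fan s L = ∃₂ λ w X → X ⊆ L × AllPairs _<ᶠ_ X × length X ≡ 2 * m × All (λ a → Path χ s a w) X

  take-length : ∀ {A : Set} k {xs : List A} → k ≤ length xs → length (take k xs) ≡ k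
  take-length k k≤ = trans (length-take k _) (m≤n⇒m⊓n≡m k≤)

  fan : ∀ s {L} → AllPairs _<ᶠ_ L → s * (4 * m) + suc (2 * m) ≤ length L → Fan s L
  fan zero {L} sorted long with drop (2 * m) L in eq
  ... | [] = ⊥-elim (<⇒≱ long (m∸n≡0⇒m≤n (trans (sym (length-drop (2 * m) L)) (cong length eq))))
  -- At level zero `Path` is only the order, so the first `2 * m` entries and the next one, `w`,
  -- suffice; `w` accounts for the `suc` in the bound.
  ... | w ∷ ws = w , take (2 * m) L , take-⊆ (2 * m) L , AllPairs.take⁺ (2 * m) sorted ,
        take-length (2 * m) (<⇒≤ long) ,
        All.map (λ { (p ∷ _) → p }) (AllPairs-++⁻ (take (2 * m) L)
          (subst (AllPairs _<ᶠ_) (sym (trans (cong (take (2 * m) L ++_) (sym eq)) (take++drop≡id (2 * m) L))) sorted))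
  fan (suc s) {L} sorted long = step (fan s (AllPairs.drop⁺ (4 * m) sorted) long′)
    where
    -- The new first vertices come from the start of `L`, so they precede the fan found in the rest.
    J = take (4 * m) L
    L′ = drop (4 * m) L

    long′ : s * (4 * m) + suc (2 * m) ≤ length L′
    long′ = subst (s * (4 * m) + suc (2 * m) ≤_) (sym (length-drop (4 * m) L))
      (m+n≤o⇒m≤o∸n _ (subst (_≤ length L) (trans (+-assoc (4 * m) _ _) (+-comm (4 * m) _)) long))

    |J| : length J ≡ 4 * m
    |J| = take-length (4 * m)
      (≤-trans (m≤m+n (4 * m) _) (subst (_≤ length L) (+-assoc (4 * m) _ _) long))

    J<L′ : All (λ v → All (v <ᶠ_) L′) J
    J<L′ = AllPairs-++⁻ J (subst (AllPairs _<ᶠ_) (sym (take++drop≡id (4 * m) L)) sorted)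

    step : Fan s L′ → Fan (suc s) L
    step (w , X , X⊆L′ , sortedX , |X| , aw) = conclude (popular (path? χ (suc s)) m X nonempty many)
      where
      nonempty : 0 < length X
      nonempty = subst (0 <_) (sym |X|) (≤-trans 0<m (m≤m+n m _))

      many : All (λ v → m ≤ count (path? χ (suc s) v) X) J
      many = All.map (λ {v} v<L′ →
        let v? = path? χ (suc s) v
            bad = ∁? v?
            -- The vertices of `X` not reached at level `suc s` from `v` satisfy the hypotheses of
            -- `few`, with the old `w` as the upper end.
            bad<m = few s v w (AllPairs.filter⁺ bad sortedX)
              (All.filter⁺ bad (All-resp-⊆ X⊆L′ v<L′)) (All.all-filter bad X) (All.filter⁺ bad aw)
        in +-cancelʳ-≤ m m _ (≤-trans
             (≤-reflexive (trans (cong (m +_) (sym (+-identityʳ m))) (trans (sym |X|) (sym (count-∁ v? X)))))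
             (+-monoʳ-≤ (count v? X) (<⇒≤ bad<m)))) J<L′

      conclude : (∃ λ a → a ∈ X × length J * m ≤ length X * count (λ v → path? χ (suc s) v a) J) →
        Fan (suc s) L
      conclude (a , a∈X , bound) =
        -- The popular vertex `a` of the old `X` becomes the common second vertex of the new fan.
        a , take (2 * m) Y , ⊆-trans (take-⊆ (2 * m) Y) (⊆-trans (filter-⊆ a? J) (take-⊆ (4 * m) L)) ,
        AllPairs.take⁺ (2 * m) (AllPairs.filter⁺ a? (AllPairs.take⁺ (4 * m) sorted)) ,
        take-length (2 * m) 2m≤ , All.take⁺ (2 * m) (All.all-filter a? J)
        where
        a? = λ v → path? χ (suc s) v a
        Y = filter a? J

        instance
          2m≢0 : NonZero (2 * m)
          2m≢0 = >-nonZero (≤-trans 0<m (m≤m+n m _))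

        2m≤ : 2 * m ≤ length Y
        -- Averaging gives 4m · m ≤ 2m · |Y|, from which `2 * m` is cancelled.
        2m≤ = *-cancelˡ-≤ (2 * m) (subst₂ _≤_
          (trans (cong (_* m) |J|) (square m)) (cong (_* length Y) |X|) bound)
          where
          square : ∀ m → 4 * m * m ≡ 2 * m * (2 * m)
          square = solve-∀

-- From the fan to the Ramsey bound.

arrows2⇒0<m : ∀ {k m} → Arrows2 (suc k) m → 0 < m
arrows2⇒0<m {m = zero} arrows with arrows (λ ())
... | _ , x , _ with x zero
...   | ()
arrows2⇒0<m {m = suc _} _ = z<s

arrows2⇒arrows3 : ∀ {k m} → Arrows2 (2 + k) m → Arrows3 (2 + k) (k * (4 * m) + suc (2 * m))
arrows2⇒arrows3 {k} {m} arrows χ = decidable-stable (goal? χ k) λ ¬goal →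
  let 0<m = arrows2⇒0<m arrows
      -- The list is all of [N] in order. A fan at level `k` suffices, since a path of level `k` has
      -- `2 + k` vertices.
      w , X , _ , _ , |X| , aw = fan arrows 0<m χ (¬goal ∘ inj₁) (¬goal ∘ inj₂) k
        (AllPairs.tabulate⁺-< λ i<j → i<j) (≤-reflexive (sym (length-tabulate λ i → i)))
  in ¬goal (inj₂ (proj₁ (path⇒bluePath χ k (head X (subst (0 <_) (sym |X|) (≤-trans 0<m (m≤m+n m _))) aw .proj₂))))
  where
  head : ∀ {A : Set} {P : A → Set} (xs : List A) → 0 < length xs → All P xs → ∃ P
  head (x ∷ _) _ (px ∷ _) = x , px

theorem6 : (n : ℕ) → 2 ≤ n → (m : ℕ) → IsR2 n m →
    Σ ℕ (λ r → IsR3 n r × r < 6 * n * m)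
theorem6 (suc zero) (s≤s ())
theorem6 (suc (suc k)) _ m (arrows , _) with least (arrows3? k) _ (arrows2⇒arrows3 arrows)
... | r , r≤ , isR3 = r , isR3 , (begin-strict
  r                                         ≤⟨ r≤ ⟩
  k * (4 * m) + suc (2 * m)                 ≡⟨ cong (k * (4 * m) +_) (+-comm 1 (2 * m)) ⟩
  k * (4 * m) + (2 * m + 1)                 <⟨ +-monoʳ-< (k * (4 * m)) (+-monoʳ-< (2 * m) 1<2*m) ⟩
  -- The slack is 6(k + 2)m - (4km + 4m) = 2km + 8m.
  k * (4 * m) + (2 * m + 2 * m)             ≤⟨ m≤m+n _ (2 * k * m + 8 * m) ⟩
  k * (4 * m) + (2 * m + 2 * m) + (2 * k * m + 8 * m)
                                            ≡⟨ expand k m ⟩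
  6 * (2 + k) * m                           ∎)
  where
  open ≤-Reasoning

  1<2*m : 1 < 2 * m
  1<2*m = *-monoʳ-≤ 2 (arrows2⇒0<m arrows)

  expand : ∀ k m →
    k * (4 * m) + (2 * m + 2 * m) + (2 * k * m + 8 * m) ≡ 6 * (2 + k) * m
  expand = solve-∀
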